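{- Suppose that $|q|<1$. Then for all integers $r\ge 0$ and $n\ge 1$: $$\beta_n^{(r)}=\begin{cases}\displaystyle -n\sum_{k=0}^{+\infty}q^k[k]^{n-1}+(1-q)^{ -n} & \text{if } r=0,\\[3mm] \displaystyle -n\sum_{k=0}^{+\infty}q^{(r+1)k}[k]^{n-1}+r(1-q)\sum_{k=0}^{+\infty}q^{rk}[k]^n & \text{if } r\ge 1.\end{cases}$$
   Context: Here $q$ is a positive real number, $q\neq 1$ (so the hypothesis means $0<q<1$), and $[X]:=\frac{q^X-1}{q-1}$. For integers $n\ge 0$ let $$\eta_n(X):=(q-1)^{ -n}\sum_{k=0}^{n}(-1)^{n-k}\binom{n}{k}\frac{k}{[k]}\,q^{kX},$$ with the convention $\frac{k}{[k]}=1$ for $k=0$. The extended Carlitz $q$-Bernoulli polynomials $\beta_n^{(r)}(X)$ ($r,n\ge 0$ integers) are defined recursively by $\beta_n^{(0)}(X):=\eta_n(X)$ and $$\beta_n^{(r+1)}(X):=q^{ -X}\left(\beta_n^{(r)}(X)+(q-1)\beta_{n+1}^{(r)}(X)\right),$$ and the extended Carlitz $q$-Bernoulli numbers of order $r$ are $\beta_n^{(r)}:=\beta_n^{(r)}(0)$. The convention $[k]^0=1$ (also for $k=0$) is used. -}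

module Defs where

open import Level using (Level; _⊔_) renaming (suc to lsuc)
open import Algebra.Bundles using (CommutativeRing)
open import Algebra.Apartness.Bundles using (HeytingField; HeytingCommutativeRing)
import Algebra.Apartness.Properties.HeytingCommutativeRing as HeytingProperties
import Algebra.Properties.Ring as RingProperties
import Algebra.Properties.Semiring.Exp as Exp
import Algebra.Properties.Semiring.Mult as Mult
import Algebra.Properties.Semiring.Sum as Sum
open import Data.Fin.Base using (toℕ)
open import Data.Nat.Base as ℕ using (ℕ; zero; suc; _∸_)
open import Data.Nat.Combinatorics using (_C_)
open import Data.Product.Base using (_×_; _,_; proj₁; proj₂; ∃-syntax)
open import Data.Sum.Base using (_⊎_; inj₁; inj₂)
open import Relation.Binary.Core using (Rel)
open import Relation.Binary.Structures using (IsStrictPartialOrder)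
import Relation.Binary.Reasoning.Setoid as SetoidReasoning

-- The real numbers, axiomatised constructively as a Cauchy-complete Archimedean
-- ordered field.  Inequality of reals is the apartness _#_.

record Reals c ℓ₁ ℓ₂ : Set (lsuc (c ⊔ ℓ₁ ⊔ ℓ₂)) where
  infix 4 _<_ ∣_∣<_ _⟶_
  field
    heytingField : HeytingField c ℓ₁ ℓ₂

  open HeytingField heytingField public

  commutativeRing : CommutativeRing c ℓ₁
  commutativeRing = HeytingCommutativeRing.commutativeRing heytingCommutativeRing

  open CommutativeRing commutativeRing public using (ring; semiring)
  open Mult semiring public using () renaming (_×_ to _·_)
  open Exp semiring public using (_^_)
  open Sum semiring public using (sum; sum-syntax; sum⁺-syntax)

  ι : ℕ → Carrier
  ι n = n · 1#

  field
    _<_                  : Rel Carrier ℓ₂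
    isStrictPartialOrder : IsStrictPartialOrder _≈_ _<_
    #⇒<⊎>                : ∀ {x y} → x # y → x < y ⊎ y < x
    <⇒#                  : ∀ {x y} → x < y → x # y
    +-monoˡ-<            : ∀ z {x y} → x < y → x + z < y + z
    *-pos                : ∀ {x y} → 0# < x → 0# < y → 0# < x * y
    archimedean          : ∀ x → ∃[ n ] x < ι n

  ∣_∣<_ : Carrier → Carrier → Set ℓ₂
  ∣ x ∣< ε = - ε < x × x < ε

  Cauchy : (ℕ → Carrier) → Set (c ⊔ ℓ₂)
  Cauchy s = ∀ ε → 0# < ε →
    ∃[ N ] (∀ m n → N ℕ.≤ m → N ℕ.≤ n → ∣ s m - s n ∣< ε)

  _⟶_ : (ℕ → Carrier) → Carrier → Set (c ⊔ ℓ₂)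
  s ⟶ l = ∀ ε → 0# < ε → ∃[ N ] (∀ n → N ℕ.≤ n → ∣ s n - l ∣< ε)

  field
    complete : ∀ s → Cauchy s → ∃[ l ] s ⟶ l

module Analysis {c ℓ₁ ℓ₂} (ℝ : Reals c ℓ₁ ℓ₂) where

  open Reals ℝ public
  open IsStrictPartialOrder isStrictPartialOrder
    using (<-respˡ-≈; <-respʳ-≈) renaming (trans to <-trans)
  open HeytingProperties heytingCommutativeRing
    using (invertibleˡ⇒#; x-0≈x; x#0y#0→xy#0; #-congʳ)
  open RingProperties ring using (-‿distribʳ-*)
  open SetoidReasoning (CommutativeRing.setoid commutativeRing)

  infix 4 _sumsTo_

  _sumsTo_ : (ℕ → Carrier) → Carrier → Set (c ⊔ ℓ₂)
  f sumsTo S = (λ N → ∑[ k < N ] f (toℕ k)) ⟶ S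

  -- For x # 0#, #⇒invertible inverts x - 0#, which is ≈ x.
  inv : ∀ x → x # 0# → Carrier
  inv x x#0 = proj₁ (#⇒invertible x#0)

  Continuous : (Carrier → Carrier) → Set (c ⊔ ℓ₂)
  Continuous f = ∀ x ε → 0# < ε →
    ∃[ δ ] 0# < δ × (∀ y → ∣ y - x ∣< δ → ∣ f y - f x ∣< ε)

  -- For q > 0, X ↦ q^X is the unique continuous map satisfying the two
  -- functional equations below.
  record RealPower (q : Carrier) : Set (c ⊔ ℓ₁ ⊔ ℓ₂) where
    field
      pow        : Carrier → Carrier
      pow-cong   : ∀ {x y} → x ≈ y → pow x ≈ pow y
      pow-+      : ∀ x y → pow (x + y) ≈ pow x * pow y
      pow-1      : pow 1# ≈ q
      continuous : Continuous pow

  #⇒-#0 : ∀ {x y} → x # y → x - y # 0#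
  #⇒-#0 {x} {y} x#y with #⇒invertible x#y
  ... | i , i*[x-y]≈1 , _ =
    invertibleˡ⇒# (i , trans (*-congˡ (x-0≈x (x - y))) i*[x-y]≈1)

  inv#0 : ∀ {x} (x#0 : x # 0#) → inv x x#0 # 0#
  inv#0 {x} x#0 = invertibleˡ⇒# (x - 0# ,
    trans (*-congˡ (x-0≈x (inv x x#0))) (proj₂ (proj₂ (#⇒invertible x#0))))

  [y-x]+x≈y : ∀ x y → (y - x) + x ≈ y
  [y-x]+x≈y x y = trans (+-assoc y (- x) x)
    (trans (+-congˡ (-‿inverseˡ x)) (+-identityʳ y))

  *-monoˡ-< : ∀ {x y z} → 0# < z → x < y → z * x < z * y
  *-monoˡ-< {x} {y} {z} 0<z x<y =
    <-respˡ-≈ (+-identityˡ (z * x))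
      (<-respʳ-≈ eq (+-monoˡ-< (z * x) (*-pos 0<z 0<y-x)))
    where
    0<y-x : 0# < y - x
    0<y-x = <-respˡ-≈ (-‿inverseʳ x) (+-monoˡ-< (- x) x<y)

    eq : z * (y - x) + z * x ≈ z * y
    eq = trans (sym (distribˡ z (y - x) x)) (*-congˡ ([y-x]+x≈y x y))

  pow<1 : ∀ {x} → 0# < x → x < 1# → ∀ k → x ^ suc k < 1#
  pow<1 {x} 0<x x<1 zero    = <-respˡ-≈ (sym (*-identityʳ x)) x<1
  pow<1 {x} 0<x x<1 (suc k) = <-trans
    (<-respʳ-≈ (*-identityʳ x) (*-monoˡ-< 0<x (pow<1 0<x x<1 k))) x<1

  1<pow : ∀ {x} → 0# < x → 1# < x → ∀ k → 1# < x ^ suc k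
  1<pow {x} 0<x 1<x zero    = <-respʳ-≈ (sym (*-identityʳ x)) 1<x
  1<pow {x} 0<x 1<x (suc k) = <-trans 1<x
    (<-respˡ-≈ (*-identityʳ x) (*-monoˡ-< 0<x (1<pow 0<x 1<x k)))

  pow#1 : ∀ {x} → 0# < x → x # 1# → ∀ k → x ^ suc k # 1#
  pow#1 0<x x#1 k with #⇒<⊎> x#1
  ... | inj₁ x<1 = <⇒# (pow<1 0<x x<1 k)
  ... | inj₂ 1<x = #-sym (<⇒# (1<pow 0<x 1<x k))

  pow-ι : ∀ {q} (P : RealPower q) → let open RealPower P in
          ∀ k → pow (ι (suc k)) ≈ q ^ suc k
  pow-ι {q} P = go
    where
    open RealPower P
    go : ∀ k → pow (ι (suc k)) ≈ q ^ suc k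
    go zero = begin
      pow (1# + 0#) ≈⟨ pow-cong (+-identityʳ 1#) ⟩
      pow 1#        ≈⟨ pow-1 ⟩
      q             ≈⟨ *-identityʳ q ⟨
      q * 1#        ∎
    go (suc k) = trans (pow-+ 1# (ι (suc k))) (*-cong pow-1 (go k))

  module Carlitz (q : Carrier) (0<q : 0# < q) (q#1 : q # 1#) (P : RealPower q) where

    open RealPower P public

    ⟨q-1⟩⁻¹ : Carrier
    ⟨q-1⟩⁻¹ = inv (q - 1#) (#⇒-#0 q#1)

    ⟨1-q⟩⁻¹ : Carrier
    ⟨1-q⟩⁻¹ = inv (1# - q) (#⇒-#0 (#-sym q#1))

    [_] : Carrier → Carrier
    [ X ] = (pow X - 1#) * ⟨q-1⟩⁻¹

    [1+k]#0 : ∀ k → [ ι (suc k) ] # 0#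
    [1+k]#0 k = x#0y#0→xy#0
      (#⇒-#0 (#-congʳ (sym (pow-ι P k)) (pow#1 0<q q#1 k)))
      (inv#0 (#⇒-#0 q#1))

    k/[k] : ℕ → Carrier
    k/[k] zero        = 1#
    k/[k] k@(suc k-1) = ι k * inv [ ι k ] ([1+k]#0 k-1)

    η : ℕ → Carrier → Carrier
    η n X = ⟨q-1⟩⁻¹ ^ n *
      (∑[ k ≤ n ] ((- 1#) ^ (n ∸ toℕ k) * ι (n C toℕ k)
                   * k/[k] (toℕ k) * pow (ι (toℕ k) * X)))

    -- βpoly r n X is β_n^{(r)}(X), and β r n is the number β_n^{(r)}.
    βpoly : (r n : ℕ) → Carrier → Carrier
    βpoly zero    n X = η n X
    βpoly (suc r) n X = pow (- X) * (βpoly r n X + (q - 1#) * βpoly r (suc n) X)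

    β : (r n : ℕ) → Carrier
    β r n = βpoly r n 0#

{-# OPTIONS --safe #-}
-- With a k = k/[k] and the difference operator Δ, Newton's formula reads
-- η_n(0) = (q-1)⁻ⁿ (Δⁿ a) 0, and the recursion defining β^{(r+1)} from β^{(r)} is the
-- shift f (r + 1) = f r + (Δ f) r.  Hence β_n^{(r)} = (q-1)⁻ⁿ (Δⁿ a) r.
-- Apart from a 0 = 1, a k is k times h k = 1/[k], so the Leibniz rule
-- Δⁿ (k · h) r = r (Δⁿ h) r + n (Δⁿ⁻¹ h) (r + 1) splits β_n^{(r)} into two terms.
-- Each of them is one of the series: Σ_k q^{rk} [k]ⁿ = -(q-1)⁻¹⁻ⁿ (Δⁿ h) r for r ≥ 1, by
-- induction on n, since multiplying the summand by [k] = (q^k - 1)/(q - 1) takes a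
-- difference in r, and the case n = 0 is the geometric series.
module Submission where

open import Defs
open import Algebra.Bundles using (CommutativeRing)
import Algebra.Apartness.Properties.HeytingCommutativeRing as HeytingProperties
import Algebra.Properties.AbelianGroup as AbelianGroupProperties
import Algebra.Properties.CommutativeSemiring.Exp as CommutativeExp
import Algebra.Properties.Ring as RingProperties
import Algebra.Properties.Semiring.Exp as Exp
import Algebra.Properties.Semiring.Mult as Mult
import Algebra.Properties.Semiring.Mult.TCOptimised as Multiple
import Algebra.Properties.Semiring.Sum as Sum
import Algebra.Solver.Ring as RingSolver
open import Algebra.Solver.Ring.AlmostCommutativeRing
  using (fromCommutativeRing; _-Raw-AlmostCommutative⟶_)
open import Data.Fin.Base using (toℕ)
open import Data.Integer.Base as ℤ using (ℤ; +_; -[1+_]; _⊖_; _◃_)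
import Data.Integer.Properties as ℤ
open import Data.Maybe.Base using (Maybe; just; nothing)
open import Data.Nat.Base as ℕ using (ℕ; zero; suc; _∸_)
open import Data.Nat.Combinatorics
  using (_C_; k>n⇒nCk≡0; nCk≡nC[n∸k]; nCn≡1; nCk+nC[k+1]≡[n+1]C[k+1])
import Data.Nat.Properties as ℕ
open import Data.Product.Base using (_×_; _,_; proj₂; ∃-syntax)
import Data.Sign.Base as Sign
open import Data.Sum.Base using (inj₁; inj₂)
open import Function.Base using (_∘_)
open import Relation.Binary.PropositionalEquality.Core as ≡ using (_≡_)
import Relation.Binary.Reasoning.Setoid as SetoidReasoning
open import Relation.Binary.Structures using (IsStrictPartialOrder)
open import Relation.Nullary.Decidable.Core using (yes; no)
open import Relation.Nullary.Negation.Core using (contradiction)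

-- A ring solver with integer coefficients.

-- Unlike coefficients in the ring itself, integer coefficients have decidable
-- equality, so the solver recognises that x - x cancels.
module IntegerSolver {c ℓ} (R : CommutativeRing c ℓ) where

  open CommutativeRing R
  open RingProperties ring using (-0#≈0#; -‿involutive; -‿distribˡ-*; -‿distribʳ-*)
  open AbelianGroupProperties +-abelianGroup using (⁻¹-∙-comm)
  open Multiple semiring using (1+×; ×-cong; ×-homo-+; ×1-homo-*) renaming (_×_ to _·_)
  open SetoidReasoning setoid

  -- With the optimised multiple, `1 · 1#` reduces to `1#`, so that `con (+ 1)` stands for `1#`
  -- itself in the solved equations.
  ⟦_⟧ : ℤ → Carrier
  ⟦ + n ⟧      = n · 1#
  ⟦ -[1+ n ] ⟧ = - (suc n · 1#)

  ⊖-homo : ∀ m n → ⟦ m ⊖ n ⟧ ≈ m · 1# - n · 1#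
  ⊖-homo zero    zero    = sym (-‿inverseʳ 0#)
  ⊖-homo zero    (suc n) = sym (+-identityˡ _)
  ⊖-homo (suc m) zero    = sym (trans (+-congˡ -0#≈0#) (+-identityʳ _))
  ⊖-homo (suc m) (suc n) rewrite ℤ.[1+m]⊖[1+n]≡m⊖n m n = begin
    ⟦ m ⊖ n ⟧                             ≈⟨ ⊖-homo m n ⟩
    -- Insert 0 = 1 - 1 in the middle and hand one unit to each side.
    m · 1# - n · 1#                       ≈⟨ +-congˡ (+-identityˡ _) ⟨
    m · 1# + (0# - n · 1#)                ≈⟨ +-congˡ (+-congʳ (-‿inverseʳ 1#)) ⟨
    m · 1# + (1# - 1# - n · 1#)           ≈⟨ +-congˡ (+-assoc _ _ _) ⟩
    m · 1# + (1# + (- 1# - n · 1#))       ≈⟨ +-assoc _ _ _ ⟨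
    m · 1# + 1# + (- 1# - n · 1#)         ≈⟨ +-cong (+-comm _ _) (⁻¹-∙-comm _ _) ⟩
    1# + m · 1# - (1# + n · 1#)           ≈⟨ +-cong (1+× m 1#) (-‿cong (1+× n 1#)) ⟨
    suc m · 1# - suc n · 1#               ∎

  +-homo : ∀ i j → ⟦ i ℤ.+ j ⟧ ≈ ⟦ i ⟧ + ⟦ j ⟧
  +-homo (+ m)      (+ n)      = ×-homo-+ 1# m n
  +-homo (+ m)      (-[1+ n ]) = ⊖-homo m (suc n)
  +-homo (-[1+ m ]) (+ n)      = trans (⊖-homo n (suc m)) (+-comm _ _)
  +-homo (-[1+ m ]) (-[1+ n ]) = begin
    - (suc (suc (m ℕ.+ n)) · 1#)     ≈⟨ -‿cong (×-cong (≡.cong suc (ℕ.+-suc m n)) refl) ⟨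
    - ((suc m ℕ.+ suc n) · 1#)       ≈⟨ -‿cong (×-homo-+ 1# (suc m) (suc n)) ⟩
    - (suc m · 1# + suc n · 1#)      ≈⟨ ⁻¹-∙-comm _ _ ⟨
    - (suc m · 1#) - suc n · 1#      ∎

  -‿homo : ∀ i → ⟦ ℤ.- i ⟧ ≈ - ⟦ i ⟧
  -‿homo (+ zero)   = sym -0#≈0#
  -‿homo (+ suc n)  = refl
  -‿homo (-[1+ n ]) = sym (-‿involutive _)

  +◃-homo : ∀ n → ⟦ Sign.+ ◃ n ⟧ ≈ n · 1#
  +◃-homo zero    = refl
  +◃-homo (suc n) = refl

  -◃-homo : ∀ n → ⟦ Sign.- ◃ n ⟧ ≈ - (n · 1#)
  -◃-homo zero    = sym -0#≈0#
  -◃-homo (suc n) = refl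

  *-homo : ∀ i j → ⟦ i ℤ.* j ⟧ ≈ ⟦ i ⟧ * ⟦ j ⟧
  *-homo (+ m)      (+ n)      = trans (+◃-homo (m ℕ.* n)) (×1-homo-* m n)
  *-homo (+ m)      (-[1+ n ]) = begin
    ⟦ Sign.- ◃ m ℕ.* suc n ⟧         ≈⟨ -◃-homo (m ℕ.* suc n) ⟩
    - ((m ℕ.* suc n) · 1#)           ≈⟨ -‿cong (×1-homo-* m (suc n)) ⟩
    - ((m · 1#) * (suc n · 1#))      ≈⟨ -‿distribʳ-* _ _ ⟩
    (m · 1#) * - (suc n · 1#)        ∎
  *-homo (-[1+ m ]) (+ n)      = begin
    ⟦ Sign.- ◃ suc m ℕ.* n ⟧         ≈⟨ -◃-homo (suc m ℕ.* n) ⟩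
    - ((suc m ℕ.* n) · 1#)           ≈⟨ -‿cong (×1-homo-* (suc m) n) ⟩
    - ((suc m · 1#) * (n · 1#))      ≈⟨ -‿distribˡ-* _ _ ⟩
    - (suc m · 1#) * (n · 1#)        ∎
  *-homo (-[1+ m ]) (-[1+ n ]) = begin
    (suc m ℕ.* suc n) · 1#           ≈⟨ ×1-homo-* (suc m) (suc n) ⟩
    (suc m · 1#) * (suc n · 1#)      ≈⟨ -‿involutive _ ⟨
    - - ((suc m · 1#) * (suc n · 1#)) ≈⟨ -‿cong (-‿distribˡ-* _ _) ⟩
    - (- (suc m · 1#) * (suc n · 1#)) ≈⟨ -‿distribʳ-* _ _ ⟩
    - (suc m · 1#) * - (suc n · 1#)  ∎

  morphism : ℤ.+-*-rawRing -Raw-AlmostCommutative⟶ fromCommutativeRing R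
  morphism = record
    { ⟦_⟧    = ⟦_⟧
    ; +-homo = +-homo
    ; *-homo = *-homo
    ; -‿homo = -‿homo
    ; 0-homo = refl
    ; 1-homo = refl
    }

  _coeff≟_ : ∀ i j → Maybe (⟦ i ⟧ ≈ ⟦ j ⟧)
  i coeff≟ j with i ℤ.≟ j
  ... | yes ≡.refl = just refl
  ... | no  _      = nothing

  open RingSolver ℤ.+-*-rawRing (fromCommutativeRing R) morphism _coeff≟_ public
    using (solve; _:=_; _:+_; _:*_; _:-_; :-_; con)

-- Finite differences of sequences in a commutative ring.

module FiniteDifferences {c ℓ} (R : CommutativeRing c ℓ) where

  open CommutativeRing R
  open IntegerSolver R using (solve; _:=_; _:+_; _:*_; _:-_; :-_; con)
  open Mult semiring using (×-homo-+; ×-congˡ) renaming (_×_ to _·_)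
  open Exp semiring using (_^_)
  open Sum semiring using (sum-syntax; sum⁺-syntax; sum-cong-≋)
  open SetoidReasoning setoid

  ∑-difference : ∀ N (f g : ℕ → Carrier) →
    ∑[ k < N ] (f (toℕ k) - g (toℕ k)) ≈ ∑[ k < N ] f (toℕ k) - ∑[ k < N ] g (toℕ k)
  ∑-difference zero    f g = sym (-‿inverseʳ 0#)
  ∑-difference (suc N) f g = trans (+-congˡ (∑-difference N (f ∘ suc) (g ∘ suc)))
    (solve 4 (λ x y F G → (x :- y) :+ (F :- G) := (x :+ F) :- (y :+ G)) refl
      (f 0) (g 0) (∑[ k < N ] f (suc (toℕ k))) (∑[ k < N ] g (suc (toℕ k))))

  ∑-last : ∀ N (f : ℕ → Carrier) → ∑[ k ≤ N ] f (toℕ k) ≈ ∑[ k < N ] f (toℕ k) + f N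
  ∑-last zero    f = +-comm (f 0) 0#
  ∑-last (suc N) f = trans (+-congˡ (∑-last N (f ∘ suc))) (sym (+-assoc _ _ _))

  Δ : ℕ → (ℕ → Carrier) → ℕ → Carrier
  Δ zero    f k = f k
  Δ (suc n) f k = Δ n f (suc k) - Δ n f k

  Δ-shift : ∀ n f k → Δ n (f ∘ suc) k ≡ Δ n f (suc k)
  Δ-shift zero    f k = ≡.refl
  Δ-shift (suc n) f k = ≡.cong₂ _-_ (Δ-shift n f (suc k)) (Δ-shift n f k)

  -- Signed binomial coefficients and Newton's formula.

  -- Coefficients of the n-th power of shift minus identity, in exactly the form in which they occur
  -- in `η`.
  signedBinomial : ℕ → ℕ → Carrier
  signedBinomial n k = (- 1#) ^ (n ∸ k) * ((n C k) · 1#)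

  signedBinomial-overflow : ∀ n → signedBinomial n (suc n) ≈ 0#
  signedBinomial-overflow n = trans
    (*-congˡ (×-congˡ (k>n⇒nCk≡0 (ℕ.n<1+n n)))) (zeroʳ _)

  -- The boundary case of the Pascal recursion, where the left neighbour is missing.
  signedBinomial-zero : ∀ n → signedBinomial (suc n) 0 ≈ - signedBinomial n 0
  signedBinomial-zero n = begin
    - 1# * (- 1#) ^ n * ((suc n C 0) · 1#)
      ≈⟨ *-congˡ (×-congˡ (≡.trans (nC0≡1 (suc n)) (≡.sym (nC0≡1 n)))) ⟩
    - 1# * (- 1#) ^ n * ((n C 0) · 1#)
      ≈⟨ solve 2 (λ x y → :- con (+ 1) :* x :* y := :- (x :* y)) refl ((- 1#) ^ n) ((n C 0) · 1#) ⟩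
    - ((- 1#) ^ n * ((n C 0) · 1#))          ∎
    where
    nC0≡1 : ∀ n → n C 0 ≡ 1
    nC0≡1 n = ≡.trans (nCk≡nC[n∸k] {0} {n} ℕ.z≤n) (nCn≡1 n)

  -- For k ≥ n the exponents n ∸ k and n ∸ suc k are both truncated to 0, which is
  -- harmless since n C suc k vanishes.
  signedBinomial-flip : ∀ n k →
    (- 1#) ^ (n ∸ k) * ((n C suc k) · 1#) ≈ - signedBinomial n (suc k)
  signedBinomial-flip n k with ℕ.<-≤-connex k n
  ... | inj₁ k<n = begin
    (- 1#) ^ (n ∸ k) * B               ≡⟨ ≡.cong (λ e → (- 1#) ^ e * B) (ℕ.+-∸-assoc 1 k<n) ⟩
    - 1# * (- 1#) ^ (n ∸ suc k) * B
      ≈⟨ solve 2 (λ x y → :- con (+ 1) :* x :* y := :- (x :* y)) refl ((- 1#) ^ (n ∸ suc k)) B ⟩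
    - ((- 1#) ^ (n ∸ suc k) * B)       ∎
    where B = (n C suc k) · 1#
  ... | inj₂ n≤k = begin
    (- 1#) ^ (n ∸ k) * B               ≈⟨ *-congˡ B≈0 ⟩
    (- 1#) ^ (n ∸ k) * 0#
      ≈⟨ solve 2 (λ x y → x :* con (+ 0) := :- (y :* con (+ 0)))
           refl ((- 1#) ^ (n ∸ k)) ((- 1#) ^ (n ∸ suc k)) ⟩
    - ((- 1#) ^ (n ∸ suc k) * 0#)      ≈⟨ -‿cong (*-congˡ B≈0) ⟨
    - ((- 1#) ^ (n ∸ suc k) * B)       ∎
    where
    B = (n C suc k) · 1#
    B≈0 : B ≈ 0#
    B≈0 = ×-congˡ (k>n⇒nCk≡0 (ℕ.s≤s n≤k))

  -- Pascal's rule; the second summand changes sign because its exponent of -1 is one too large.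
  signedBinomial-pascal : ∀ n k →
    signedBinomial (suc n) (suc k) ≈ signedBinomial n k - signedBinomial n (suc k)
  signedBinomial-pascal n k = begin
    s * ((suc n C suc k) · 1#)
      ≈⟨ *-congˡ (×-congˡ (nCk+nC[k+1]≡[n+1]C[k+1] n k)) ⟨
    s * ((n C k ℕ.+ n C suc k) · 1#)               ≈⟨ *-congˡ (×-homo-+ 1# (n C k) (n C suc k)) ⟩
    s * ((n C k) · 1# + (n C suc k) · 1#)          ≈⟨ distribˡ s _ _ ⟩
    signedBinomial n k + s * ((n C suc k) · 1#)    ≈⟨ +-congˡ (signedBinomial-flip n k) ⟩
    signedBinomial n k - signedBinomial n (suc k)  ∎
    where s = (- 1#) ^ (n ∸ k)

  -- Induction on n for all `f` at once: Pascal's rule splits the sum of order n + 1 into the sum of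
  -- order n for `f ∘ suc` minus the one for `f`.
  newton : ∀ n (f : ℕ → Carrier) →
    ∑[ k ≤ n ] (signedBinomial n (toℕ k) * f (toℕ k)) ≈ Δ n f 0
  newton zero    f = solve 1
    (λ x → con (+ 1) :* (con (+ 1) :+ con (+ 0)) :* x :+ con (+ 0) := x) refl (f 0)
  newton (suc n) f = begin
    w (suc n) 0 * f 0 + ∑[ k ≤ n ] (w (suc n) (suc (toℕ k)) * f (suc (toℕ k)))
      ≈⟨ +-cong (*-congʳ (signedBinomial-zero n)) (sum-cong-≋ {suc n} (λ k → term (toℕ k))) ⟩
    - w n 0 * f 0 + ∑[ k ≤ n ] (F (toℕ k) - G (suc (toℕ k)))
      ≈⟨ +-congˡ (∑-difference (suc n) F (G ∘ suc)) ⟩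
    - w n 0 * f 0 + (∑F - ∑[ k ≤ n ] G (suc (toℕ k)))
      ≈⟨ solve 4 (λ w x F G → :- w :* x :+ (F :- G) := F :- (w :* x :+ G)) refl
           (w n 0) (f 0) ∑F (∑[ k ≤ n ] G (suc (toℕ k))) ⟩
    ∑F - ∑[ k ≤ suc n ] G (toℕ k)
      -- The subtracted sum runs one index too far; its last term, at n + 1, vanishes with the
      -- binomial coefficient.
      ≈⟨ +-congˡ (-‿cong (∑-last (suc n) G)) ⟩
    ∑F - (∑[ k ≤ n ] G (toℕ k) + G (suc n))
      ≈⟨ +-cong (newton n (f ∘ suc)) (-‿cong (+-cong (newton n f)
           (trans (*-congʳ (signedBinomial-overflow n)) (zeroˡ _)))) ⟩
    Δ n (f ∘ suc) 0 - (Δ n f 0 + 0#)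
      ≈⟨ +-cong (reflexive (Δ-shift n f 0)) (-‿cong (+-identityʳ _)) ⟩
    Δ n f 1 - Δ n f 0 ∎
    where
    w = signedBinomial
    F G : ℕ → Carrier
    F k = w n k * f (suc k)
    G k = w n k * f k
    ∑F = ∑[ k ≤ n ] F (toℕ k)
    term : ∀ k → w (suc n) (suc k) * f (suc k) ≈ F k - G (suc k)
    term k = trans (*-congʳ (signedBinomial-pascal n k))
      (solve 3 (λ x y z → (x :- y) :* z := x :* z :- y :* z) refl (w n k) (w n (suc k)) (f (suc k)))

  -- The influence of the value at 0, and the Leibniz rule.

  -- Differences look only at the given index and later ones, so from a positive index the value at
  -- 0 is invisible.
  Δ-cong-suc : ∀ {f g} → (∀ k → f (suc k) ≈ g (suc k)) → ∀ n k → Δ n f (suc k) ≈ Δ n g (suc k)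
  Δ-cong-suc f≈g zero    k = f≈g k
  Δ-cong-suc f≈g (suc n) k = +-cong (Δ-cong-suc f≈g n (suc k)) (-‿cong (Δ-cong-suc f≈g n k))

  -- The value at 0 enters the n-th difference at 0 with coefficient (-1)^n. This accounts for the
  -- convention that k/[k] is 1 at k = 0.
  Δ-perturb-zero : ∀ {f g} → (∀ k → f (suc k) ≈ g (suc k)) →
    ∀ n → Δ n f 0 ≈ Δ n g 0 + (- 1#) ^ n * (f 0 - g 0)
  Δ-perturb-zero {f} {g} f≈g zero    =
    solve 2 (λ x y → x := y :+ con (+ 1) :* (x :- y)) refl (f 0) (g 0)
  Δ-perturb-zero {f} {g} f≈g (suc n) = begin
    Δ n f 1 - Δ n f 0
      ≈⟨ +-cong (Δ-cong-suc f≈g n 0) (-‿cong (Δ-perturb-zero f≈g n)) ⟩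
    Δ n g 1 - (Δ n g 0 + (- 1#) ^ n * (f 0 - g 0))
      ≈⟨ solve 4 (λ x y s d → x :- (y :+ s :* d) := (x :- y) :+ :- con (+ 1) :* s :* d) refl
           (Δ n g 1) (Δ n g 0) ((- 1#) ^ n) (f 0 - g 0) ⟩
    Δ n g 1 - Δ n g 0 + - 1# * (- 1#) ^ n * (f 0 - g 0) ∎

  -- The second difference of k ↦ k vanishes, so only two terms of the general product rule survive.
  Δ-leibniz : ∀ n (f : ℕ → Carrier) r →
    Δ (suc n) (λ k → (k · 1#) * f k) r ≈ (r · 1#) * Δ (suc n) f r + (suc n · 1#) * Δ n f (suc r)
  Δ-leibniz zero f r =
    solve 3 (λ m x y → (con (+ 1) :+ m) :* y :- m :* x :=
                       m :* (y :- x) :+ (con (+ 1) :+ con (+ 0)) :* y)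
      refl (r · 1#) (f r) (f (suc r))
  Δ-leibniz (suc n) f r = trans
    (+-cong (Δ-leibniz n f (suc r)) (-‿cong (Δ-leibniz n f r)))
    (solve 5 (λ m n x y z → (con (+ 1) :+ m) :* (z :- y) :+ n :* z :- (m :* x :+ n :* y) :=
                            m :* (z :- y :- x) :+ (con (+ 1) :+ n) :* (z :- y))
      refl (r · 1#) (suc n · 1#) (Δ (suc n) f r) (Δ n f (suc r)) (Δ n f (suc (suc r))))

-- Arithmetic of the ordered field.

module Limits {c ℓ₁ ℓ₂} (ℝ : Reals c ℓ₁ ℓ₂) where

  open Analysis ℝ
  open IsStrictPartialOrder isStrictPartialOrder
    using (irrefl; <-respˡ-≈; <-respʳ-≈) renaming (trans to <-trans)
  open HeytingProperties heytingCommutativeRing using (1#0; x-0≈x; invertibleˡ⇒#)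
  open RingProperties (CommutativeRing.ring commutativeRing) using (-0#≈0#)
  open IntegerSolver commutativeRing using (solve; _:=_; _:+_; _:*_; _:-_; :-_; con)
  open FiniteDifferences commutativeRing using (∑-difference)
  open Sum semiring using (sum-cong-≋; *-distribˡ-sum)
  open SetoidReasoning (CommutativeRing.setoid commutativeRing)

  +-mono-< : ∀ {x y u v} → x < y → u < v → x + u < y + v
  +-mono-< {x} {y} {u} {v} x<y u<v = <-trans (+-monoˡ-< u x<y)
    (<-respˡ-≈ (+-comm u y) (<-respʳ-≈ (+-comm v y) (+-monoˡ-< y u<v)))

  +-pos : ∀ {x y} → 0# < x → 0# < y → 0# < x + y
  +-pos 0<x 0<y = <-respˡ-≈ (+-identityˡ 0#) (+-mono-< 0<x 0<y)

  -‿anti-mono-< : ∀ {x y} → x < y → - y < - x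
  -‿anti-mono-< {x} {y} x<y = <-respˡ-≈
    (solve 2 (λ x y → x :+ (:- x :- y) := :- y) refl x y)
    (<-respʳ-≈ (solve 2 (λ x y → y :+ (:- x :- y) := :- x) refl x y)
      (+-monoˡ-< (- x - y) x<y))

  x<y⇒0<y-x : ∀ {x y} → x < y → 0# < y - x
  x<y⇒0<y-x {x} x<y = <-respˡ-≈ (-‿inverseʳ x) (+-monoˡ-< (- x) x<y)

  x<0⇒0<-x : ∀ {x} → x < 0# → 0# < - x
  x<0⇒0<-x x<0 = <-respˡ-≈ -0#≈0# (-‿anti-mono-< x<0)

  0<1 : 0# < 1#
  0<1 with #⇒<⊎> 1#0
  ... | inj₂ 0<1 = 0<1
  -- If 1 were negative, then (-1)(-1) = 1 would be positive.
  ... | inj₁ 1<0 = <-respʳ-≈ (solve 0 (:- con (+ 1) :* :- con (+ 1) := con (+ 1)) refl)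
    (*-pos (x<0⇒0<-x 1<0) (x<0⇒0<-x 1<0))

  x*inv[x]≈1 : ∀ {x} (x#0 : x # 0#) → x * inv x x#0 ≈ 1#
  x*inv[x]≈1 {x} x#0 = trans (*-congʳ (sym (x-0≈x x))) (proj₂ (proj₂ (#⇒invertible x#0)))

  -- Being invertible, y is apart from 0 and so has a sign; a negative y would make 1 = x * y
  -- negative.
  inverse-pos : ∀ {x y} → 0# < x → x * y ≈ 1# → 0# < y
  inverse-pos {x} {y} 0<x xy≈1
    with #⇒<⊎> (invertibleˡ⇒# {y} {0#} (x , trans (*-congˡ (x-0≈x y)) xy≈1))
  ... | inj₂ 0<y = 0<y
  ... | inj₁ y<0 = contradiction (<-trans 0<1 1<0) (irrefl refl)
    where
    1<0 : 1# < 0#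
    1<0 = <-respˡ-≈ xy≈1 (<-respʳ-≈ (zeroʳ x) (*-monoˡ-< 0<x y<0))

  reciprocal : ∀ {x} → 0# < x → ∃[ y ] 0# < y × x * y ≈ 1#
  reciprocal {x} 0<x = inv x x#0 , inverse-pos 0<x (x*inv[x]≈1 x#0) , x*inv[x]≈1 x#0
    where x#0 = #-sym (<⇒# 0<x)

  <-ι-mono : ∀ {x} m n → m ℕ.≤ n → x < ι m → x < ι n
  <-ι-mono {x} _ _ m≤n = go (ℕ.≤⇒≤′ m≤n)
    where
    go : ∀ {m n} → m ℕ.≤′ n → x < ι m → x < ι n
    go (ℕ.≤′-reflexive ≡.refl) x<ιm = x<ιm
    go (ℕ.≤′-step m≤n)         x<ιm = <-respˡ-≈ (+-identityˡ x) (+-mono-< 0<1 (go m≤n x<ιm))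

  ^-pos : ∀ {x} → 0# < x → ∀ n → 0# < x ^ n
  ^-pos 0<x zero    = 0<1
  ^-pos 0<x (suc n) = *-pos 0<x (^-pos 0<x n)

  ^-inverse : ∀ {x y} → x * y ≈ 1# → ∀ n → x ^ n * y ^ n ≈ 1#
  ^-inverse xy≈1 zero = *-identityˡ 1#
  ^-inverse {x} {y} xy≈1 (suc n) = begin
    x * x ^ n * (y * y ^ n)
      ≈⟨ solve 4 (λ x X y Y → x :* X :* (y :* Y) := x :* y :* (X :* Y)) refl x (x ^ n) y (y ^ n) ⟩
    x * y * (x ^ n * y ^ n)   ≈⟨ *-cong xy≈1 (^-inverse xy≈1 n) ⟩
    1# * 1#                   ≈⟨ *-identityˡ 1# ⟩
    1#                        ∎

  -- Bounds on absolute values.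

  ∣∣<-cong : ∀ {x y δ ε} → x ≈ y → δ ≈ ε → ∣ x ∣< δ → ∣ y ∣< ε
  ∣∣<-cong x≈y δ≈ε (-δ<x , x<δ) =
    <-respˡ-≈ (-‿cong δ≈ε) (<-respʳ-≈ x≈y -δ<x) , <-respˡ-≈ x≈y (<-respʳ-≈ δ≈ε x<δ)

  ∣∣<-+ : ∀ {x y δ ε} → ∣ x ∣< δ → ∣ y ∣< ε → ∣ x + y ∣< δ + ε
  ∣∣<-+ {δ = δ} {ε} (-δ<x , x<δ) (-ε<y , y<ε) =
    <-respˡ-≈ (solve 2 (λ δ ε → :- δ :- ε := :- (δ :+ ε)) refl δ ε) (+-mono-< -δ<x -ε<y) ,
    +-mono-< x<δ y<ε

  ∣∣<-neg : ∀ {x ε} → ∣ x ∣< ε → ∣ - x ∣< ε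
  ∣∣<-neg {ε = ε} (-ε<x , x<ε) = -‿anti-mono-< x<ε ,
    <-respʳ-≈ (solve 1 (λ ε → :- :- ε := ε) refl ε) (-‿anti-mono-< -ε<x)

  ∣∣<-scale : ∀ {p x ε} → 0# < p → ∣ x ∣< ε → ∣ p * x ∣< p * ε
  ∣∣<-scale {p} {ε = ε} 0<p (-ε<x , x<ε) =
    <-respˡ-≈ (solve 2 (λ p ε → p :* :- ε := :- (p :* ε)) refl p ε) (*-monoˡ-< 0<p -ε<x) ,
    *-monoˡ-< 0<p x<ε

  -- Limits of sequences.

  ⟶-cong : ∀ {s t l m} → (∀ n → s n ≈ t n) → l ≈ m → s ⟶ l → t ⟶ m
  ⟶-cong s≈t l≈m s⟶l ε 0<ε with s⟶l ε 0<ε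
  ... | N , close = N , λ n N≤n → ∣∣<-cong (+-cong (s≈t n) (-‿cong l≈m)) refl (close n N≤n)

  ⟶-const : ∀ l → (λ _ → l) ⟶ l
  ⟶-const l ε 0<ε = 0 , λ _ _ →
    <-respʳ-≈ (trans -0#≈0# (sym (-‿inverseʳ l))) (-‿anti-mono-< 0<ε) ,
    <-respˡ-≈ (sym (-‿inverseʳ l)) 0<ε

  ⟶-neg : ∀ {s l} → s ⟶ l → (λ n → - s n) ⟶ - l
  ⟶-neg {s} {l} s⟶l ε 0<ε with s⟶l ε 0<ε
  ... | N , close = N , λ n N≤n → ∣∣<-cong
    (solve 2 (λ x l → :- (x :- l) := :- x :- :- l) refl (s n) l) refl (∣∣<-neg (close n N≤n))

  ⟶-+ : ∀ {s t l m} → s ⟶ l → t ⟶ m → (λ n → s n + t n) ⟶ l + m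
  ⟶-+ {s} {t} {l} {m} s⟶l t⟶m ε 0<ε with reciprocal (+-pos 0<1 0<1)
  ... | ½ , 0<½ , 2*½≈1 with s⟶l (½ * ε) (*-pos 0<½ 0<ε) | t⟶m (½ * ε) (*-pos 0<½ 0<ε)
  ... | M , s-close | N , t-close = M ℕ.⊔ N , λ n M⊔N≤n → ∣∣<-cong
    (solve 4 (λ x l y m → (x :- l) :+ (y :- m) := x :+ y :- (l :+ m)) refl (s n) l (t n) m)
    ½ε+½ε≈ε
    (∣∣<-+ (s-close n (ℕ.m⊔n≤o⇒m≤o M N M⊔N≤n)) (t-close n (ℕ.m⊔n≤o⇒n≤o M N M⊔N≤n)))
    where
    ½ε+½ε≈ε : ½ * ε + ½ * ε ≈ ε
    ½ε+½ε≈ε = begin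
      ½ * ε + ½ * ε
        ≈⟨ solve 2 (λ h ε → h :* ε :+ h :* ε := (con (+ 1) :+ con (+ 1)) :* h :* ε) refl ½ ε ⟩
      (1# + 1#) * ½ * ε   ≈⟨ *-congʳ 2*½≈1 ⟩
      1# * ε              ≈⟨ *-identityˡ ε ⟩
      ε                   ∎

  ⟶-*-pos : ∀ {p s l} → 0# < p → s ⟶ l → (λ n → p * s n) ⟶ p * l
  ⟶-*-pos {p} {s} {l} 0<p s⟶l ε 0<ε with reciprocal 0<p
  ... | p⁻¹ , 0<p⁻¹ , pp⁻¹≈1 with s⟶l (p⁻¹ * ε) (*-pos 0<p⁻¹ 0<ε)
  ... | N , close = N , λ n N≤n → ∣∣<-cong
    (solve 3 (λ p x l → p :* (x :- l) := p :* x :- p :* l) refl p (s n) l)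
    (trans (sym (*-assoc p p⁻¹ ε)) (trans (*-congʳ pp⁻¹≈1) (*-identityˡ ε)))
    (∣∣<-scale 0<p (close n N≤n))

  -- Any c is a difference (c + m) - m of positive numbers, which reduces
  -- scaling by c to scaling by positive numbers.
  ⟶-* : ∀ c {s l} → s ⟶ l → (λ n → c * s n) ⟶ c * l
  ⟶-* c {s} {l} s⟶l with archimedean (- c)
  ... | N , -c<ιN = ⟶-cong (λ n → eq (s n)) (eq l)
    (⟶-+ (⟶-*-pos 0<c+m s⟶l) (⟶-*-pos 0<m (⟶-neg s⟶l)))
    where
    -- The successor makes m positive even if N is 0.
    m = ι (suc N)
    eq : ∀ x → (c + m) * x + m * - x ≈ c * x
    eq = solve 3 (λ c m x → (c :+ m) :* x :+ m :* :- x := c :* x) refl c m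
    0<m : 0# < m
    0<m = <-ι-mono 1 (suc N) (ℕ.s≤s ℕ.z≤n) (<-respʳ-≈ (sym (+-identityʳ 1#)) 0<1)
    0<c+m : 0# < c + m
    0<c+m = <-respˡ-≈ (-‿inverseˡ c) (<-respʳ-≈ (+-comm m c)
      (+-monoˡ-< c (<-ι-mono N (suc N) (ℕ.n≤1+n N) -c<ιN)))

  -- Bernoulli's inequality and the geometric series.

  -- Bernoulli's inequality with the summand 1 dropped, which makes it strict. In the induction, (1
  -- + h)^(n+1) is split as h (1 + h)^n + (1 + h)^n, and the first summand exceeds h.
  bernoulli : ∀ {h} → 0# < h → ∀ n → ι (suc n) * h < (1# + h) ^ suc n
  bernoulli {h} 0<h zero = <-respˡ-≈
    (solve 1 (λ h → con (+ 0) :+ h := (con (+ 1) :+ con (+ 0)) :* h) refl h)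
    (<-respʳ-≈ (sym (*-identityʳ (1# + h))) (+-monoˡ-< h 0<1))
  bernoulli {h} 0<h (suc n) = <-respˡ-≈
    (solve 2 (λ h m → h :* con (+ 1) :+ m :* h := (con (+ 1) :+ m) :* h) refl h (ι (suc n)))
    (<-respʳ-≈
      (solve 2 (λ h y → h :* y :+ y := (con (+ 1) :+ h) :* y) refl h ((1# + h) ^ suc n))
      (+-mono-< (*-monoˡ-< 0<h (1<pow (+-pos 0<1 0<h) 1<1+h n)) (bernoulli 0<h n)))
    where
    1<1+h : 1# < 1# + h
    1<1+h = <-respˡ-≈ (+-identityˡ 1#) (<-respʳ-≈ (+-comm h 1#) (+-monoˡ-< 1# 0<h))

  -- By Bernoulli, x^n = 1/(1 + h)^n < 1/(n h), which is below ε once n exceeds z = 1/(h ε).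
  [1+h]⁻¹^⟶0 : ∀ {x h} → 0# < x → 0# < h → x * (1# + h) ≈ 1# → (x ^_) ⟶ 0#
  [1+h]⁻¹^⟶0 {x} {h} 0<x 0<h x[1+h]≈1 ε 0<ε with reciprocal (*-pos 0<h 0<ε)
  ... | z , 0<z , hεz≈1 with archimedean z
  -- The threshold `suc N` excludes the exponent 0, which `bernoulli` does not cover.
  ... | N , z<ιN = suc N , close
    where
    ∣x^[1+n]∣<ε : ∀ n → z < ι (suc n) → ∣ x ^ suc n ∣< ε
    ∣x^[1+n]∣<ε n z<ι =
      <-trans (<-respʳ-≈ -0#≈0# (-‿anti-mono-< 0<ε)) (^-pos 0<x (suc n)) ,
      <-respˡ-≈ (*-identityʳ X) (<-respʳ-≈ XεY≈ε
      (*-monoˡ-< (^-pos 0<x (suc n)) (<-trans 1<εhι (*-monoˡ-< 0<ε (bernoulli 0<h n)))))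
      where
      X = x ^ suc n
      Y = (1# + h) ^ suc n
      1<εhι : 1# < ε * (ι (suc n) * h)
      1<εhι = <-respˡ-≈ hεz≈1 (<-respʳ-≈
        (solve 3 (λ h ε m → h :* ε :* m := ε :* (m :* h)) refl h ε (ι (suc n)))
        (*-monoˡ-< (*-pos 0<h 0<ε) z<ι))
      XεY≈ε : X * (ε * Y) ≈ ε
      XεY≈ε = begin
        X * (ε * Y)   ≈⟨ solve 3 (λ X ε Y → X :* (ε :* Y) := ε :* (X :* Y)) refl X ε Y ⟩
        ε * (X * Y)   ≈⟨ *-congˡ (^-inverse x[1+h]≈1 (suc n)) ⟩
        ε * 1#        ≈⟨ *-identityʳ ε ⟩
        ε             ∎
    close : ∀ n → suc N ℕ.≤ n → ∣ x ^ n - 0# ∣< ε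
    close (suc n) (ℕ.s≤s N≤n) = ∣∣<-cong (sym (x-0≈x (x ^ suc n))) refl
      (∣x^[1+n]∣<ε n (<-ι-mono N (suc n) (ℕ.m≤n⇒m≤1+n N≤n) z<ιN))

  ^⟶0 : ∀ {x} → 0# < x → x < 1# → (x ^_) ⟶ 0#
  ^⟶0 {x} 0<x x<1 with reciprocal 0<x
  ... | y , 0<y , xy≈1 = [1+h]⁻¹^⟶0 0<x 0<y-1
    (trans (*-congˡ (solve 1 (λ y → con (+ 1) :+ (y :- con (+ 1)) := y) refl y)) xy≈1)
    where
    0<y-1 : 0# < y - 1#
    -- For y = 1/x, the number y - 1 equals y (1 - x), a product of positive numbers.
    0<y-1 = <-respʳ-≈
      (trans (solve 2 (λ x y → y :* (con (+ 1) :- x) := y :- x :* y) refl x y)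
        (+-congˡ (-‿cong xy≈1)))
      (*-pos 0<y (x<y⇒0<y-x x<1))

  sumsTo-cong : ∀ f g {S T} → (∀ k → f k ≈ g k) → S ≈ T → f sumsTo S → g sumsTo T
  sumsTo-cong f g f≈g S≈T = ⟶-cong (λ N → sum-cong-≋ {N} (λ k → f≈g (toℕ k))) S≈T

  sumsTo-scaled-difference : ∀ c f g {S T} → f sumsTo S → g sumsTo T →
    (λ k → c * (f k - g k)) sumsTo c * (S - T)
  sumsTo-scaled-difference c f g f-sums g-sums = ⟶-cong
    (λ N → trans (*-congˡ (sym (∑-difference N f g))) (*-distribˡ-sum {N} c _))
    refl (⟶-* c (⟶-+ f-sums (⟶-neg g-sums)))

  ∑-geometric : ∀ x N → (1# - x) * ∑[ k < N ] (x ^ toℕ k) ≈ 1# - x ^ N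
  ∑-geometric x zero    =
    solve 1 (λ x → (con (+ 1) :- x) :* con (+ 0) := con (+ 1) :- con (+ 1)) refl x
  ∑-geometric x (suc N) = begin
    (1# - x) * (1# + ∑[ k < N ] (x * x ^ toℕ k))   ≈⟨ *-congˡ (+-congˡ (*-distribˡ-sum {N} x _)) ⟨
    (1# - x) * (1# + x * Σx)
      ≈⟨ solve 2 (λ x S → (con (+ 1) :- x) :* (con (+ 1) :+ x :* S)
           := (con (+ 1) :- x) :+ x :* ((con (+ 1) :- x) :* S)) refl x Σx ⟩
    1# - x + x * ((1# - x) * Σx)                   ≈⟨ +-congˡ (*-congˡ (∑-geometric x N)) ⟩
    1# - x + x * (1# - x ^ N)
      ≈⟨ solve 2 (λ x X → (con (+ 1) :- x) :+ x :* (con (+ 1) :- X) := con (+ 1) :- x :* X)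
           refl x (x ^ N) ⟩
    1# - x * x ^ N                                 ∎
    where Σx = ∑[ k < N ] (x ^ toℕ k)

  -- The partial sums are g - g x^N. Taking any g with (1 - x) g = 1 lets the closed form built from
  -- `1/[k]` serve directly as the limit.
  geometric : ∀ {x g} → 0# < x → x < 1# → (1# - x) * g ≈ 1# → (x ^_) sumsTo g
  geometric {x} {g} 0<x x<1 [1-x]g≈1 = ⟶-cong partial-sum
    (solve 1 (λ g → g :+ :- g :* con (+ 0) := g) refl g)
    (⟶-+ (⟶-const g) (⟶-* (- g) (^⟶0 0<x x<1)))
    where
    partial-sum : ∀ N → g + - g * x ^ N ≈ ∑[ k < N ] (x ^ toℕ k)
    partial-sum N = begin
      g + - g * x ^ N
        ≈⟨ solve 2 (λ g X → g :+ :- g :* X := g :* (con (+ 1) :- X)) refl g (x ^ N) ⟩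
      g * (1# - x ^ N)         ≈⟨ *-congˡ (∑-geometric x N) ⟨
      g * ((1# - x) * Σx)
        ≈⟨ solve 3 (λ g y S → g :* (y :* S) := y :* g :* S) refl g (1# - x) Σx ⟩
      (1# - x) * g * Σx        ≈⟨ *-congʳ [1-x]g≈1 ⟩
      1# * Σx                  ≈⟨ *-identityˡ Σx ⟩
      Σx                       ∎
      where Σx = ∑[ k < N ] (x ^ toℕ k)

-- Constants and powers of q.

module CarlitzSums {c ℓ₁ ℓ₂} (ℝ : Reals c ℓ₁ ℓ₂)
  (q : Reals.Carrier ℝ) (0<q : Reals._<_ ℝ (Reals.0# ℝ) q) (q#1 : Reals._#_ ℝ q (Reals.1# ℝ))
  (P : Analysis.RealPower ℝ q) where

  open Analysis ℝ
  open Carlitz q 0<q q#1 P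
  open Limits ℝ
  open FiniteDifferences commutativeRing
    using (Δ; newton; signedBinomial; Δ-leibniz; Δ-cong-suc; Δ-perturb-zero)
  open IntegerSolver commutativeRing using (solve; _:=_; _:+_; _:*_; _:-_; :-_; con)
  open CommutativeRing commutativeRing using (commutativeSemiring)
  open RingProperties ring using (-0#≈0#)
  open CommutativeExp commutativeSemiring using (^-distrib-*)
  open Exp semiring using (^-congˡ; ^-congʳ; ^-homo-*; ^-assocʳ)
  open Sum semiring using (sum-cong-≋)
  open SetoidReasoning (CommutativeRing.setoid commutativeRing)

  private
    u v : Carrier
    u = ⟨q-1⟩⁻¹
    v = ⟨1-q⟩⁻¹

  [q-1]u≈1 : (q - 1#) * u ≈ 1#
  [q-1]u≈1 = x*inv[x]≈1 (#⇒-#0 q#1)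

  v≈-u : v ≈ - 1# * u
  v≈-u = begin
    v                        ≈⟨ *-identityʳ v ⟨
    v * 1#                   ≈⟨ *-congˡ [q-1]u≈1 ⟨
    v * ((q - 1#) * u)
      ≈⟨ solve 3 (λ q u v → v :* ((q :- con (+ 1)) :* u)
           := (con (+ 1) :- q) :* v :* (:- con (+ 1) :* u)) refl q u v ⟩
    (1# - q) * v * (- 1# * u) ≈⟨ *-congʳ (x*inv[x]≈1 (#⇒-#0 (#-sym q#1))) ⟩
    1# * (- 1# * u)          ≈⟨ *-identityˡ _ ⟩
    - 1# * u                 ∎

  -- The functional equation at 1 + 0 gives q = q * `pow 0#`, and q is invertible.
  pow-0 : pow 0# ≈ 1#
  pow-0 with reciprocal 0<q
  ... | y , _ , qy≈1 = begin
    pow 0#                   ≈⟨ *-identityˡ _ ⟨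
    1# * pow 0#              ≈⟨ *-congʳ qy≈1 ⟨
    q * y * pow 0#           ≈⟨ solve 3 (λ q y p → q :* y :* p := y :* (q :* p)) refl q y (pow 0#) ⟩
    y * (q * pow 0#)         ≈⟨ *-congˡ (*-congʳ pow-1) ⟨
    y * (pow 1# * pow 0#)    ≈⟨ *-congˡ (pow-+ 1# 0#) ⟨
    y * pow (1# + 0#)        ≈⟨ *-congˡ (pow-cong (+-identityʳ 1#)) ⟩
    y * pow 1#               ≈⟨ *-congˡ pow-1 ⟩
    y * q                    ≈⟨ *-comm y q ⟩
    q * y                    ≈⟨ qy≈1 ⟩
    1#                       ∎

  pow-ι≈^ : ∀ k → pow (ι k) ≈ q ^ k
  pow-ι≈^ zero    = pow-0
  pow-ι≈^ (suc k) = pow-ι P k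

  [ι]≈ : ∀ k → [ ι k ] ≈ (q ^ k - 1#) * u
  [ι]≈ k = *-congʳ (+-congʳ (pow-ι≈^ k))

  -- The numbers `β` as finite differences.

  β≈Δ : ∀ r n → β r n ≈ u ^ n * Δ n k/[k] r
  β≈Δ zero n = *-congˡ (trans (sum-cong-≋ {suc n} (λ k → term (toℕ k))) (newton n k/[k]))
    where
    term : ∀ k → signedBinomial n k * k/[k] k * pow (ι k * 0#) ≈ signedBinomial n k * k/[k] k
    term k = trans (*-congˡ (trans (pow-cong (zeroʳ (ι k))) pow-0)) (*-identityʳ _)
  β≈Δ (suc r) n = begin
    pow (- 0#) * (β r n + (q - 1#) * β r (suc n))
      ≈⟨ *-cong (trans (pow-cong -0#≈0#) pow-0) (+-cong (β≈Δ r n) (*-congˡ (β≈Δ r (suc n)))) ⟩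
    -- Order n + 1 brings one more factor `u`, which cancels q - 1; then D + (D′ - D) collapses to
    -- D′.
    1# * (u ^ n * D + (q - 1#) * (u * u ^ n * (D′ - D)))
      ≈⟨ solve 5 (λ q u U D D′ → con (+ 1) :* (U :* D :+ (q :- con (+ 1)) :* (u :* U :* (D′ :- D)))
           := U :* D :+ (q :- con (+ 1)) :* u :* (U :* (D′ :- D))) refl q u (u ^ n) D D′ ⟩
    u ^ n * D + (q - 1#) * u * (u ^ n * (D′ - D))
      ≈⟨ +-congˡ (*-congʳ [q-1]u≈1) ⟩
    u ^ n * D + 1# * (u ^ n * (D′ - D))
      ≈⟨ solve 3 (λ U D D′ → U :* D :+ con (+ 1) :* (U :* (D′ :- D)) := U :* D′) refl (u ^ n) D D′ ⟩
    u ^ n * D′ ∎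
    where
    D  = Δ n k/[k] r
    D′ = Δ n k/[k] (suc r)

  -- The series as finite differences of 1/[k].

  -- The value at 0 is junk: it only enters multiplied by ι 0.
  1/[k] : ℕ → Carrier
  1/[k] zero    = 0#
  1/[k] (suc k) = inv [ ι (suc k) ] ([1+k]#0 k)

  [q^k-1]*u*1/[k]≈1 : ∀ k → (q ^ suc k - 1#) * u * 1/[k] (suc k) ≈ 1#
  [q^k-1]*u*1/[k]≈1 k = trans (*-congʳ (sym ([ι]≈ (suc k)))) (x*inv[x]≈1 ([1+k]#0 k))

  qTerm : ℕ → ℕ → ℕ → Carrier
  qTerm r n k = q ^ (r ℕ.* k) * [ ι k ] ^ n

  -- The closed form of the series of `qTerm r n` for r ≥ 1. Working with it keeps the algebra for
  -- `β` separate from convergence.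
  qSum : ℕ → ℕ → Carrier
  qSum r n = - u * (u ^ n * Δ n 1/[k] r)

  -- The induction on n keeps r general, since its step uses the sums at two consecutive values of
  -- r.
  sumsTo-qSum : q < 1# → ∀ n r → qTerm (suc r) n sumsTo qSum (suc r) n
  sumsTo-qSum q<1 zero r = sumsTo-cong ((q ^ suc r) ^_) (qTerm (suc r) 0)
    (λ k → trans (^-assocʳ q (suc r) k) (sym (*-identityʳ _))) refl
    -- The ratio is q^(r+1), and -u/[r+1] is the inverse of 1 - q^(r+1).
    (geometric (^-pos 0<q (suc r)) (pow<1 0<q q<1 r) (begin
      (1# - q ^ suc r) * (- u * (1# * h))
        ≈⟨ solve 3 (λ Q u h → (con (+ 1) :- Q) :* (:- u :* (con (+ 1) :* h))
             := (Q :- con (+ 1)) :* u :* h) refl (q ^ suc r) u h ⟩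
      (q ^ suc r - 1#) * u * h              ≈⟨ [q^k-1]*u*1/[k]≈1 r ⟩
      1#                                    ∎))
    where h = 1/[k] (suc r)
  sumsTo-qSum q<1 (suc n) r = sumsTo-cong
    (λ k → u * (qTerm (suc (suc r)) n k - qTerm (suc r) n k)) (qTerm (suc r) (suc n)) term
    (solve 4 (λ u U D D′ → u :* (:- u :* (U :* D′) :- :- u :* (U :* D))
        := :- u :* (u :* U :* (D′ :- D)))
      refl u (u ^ n) (Δ n 1/[k] (suc r)) (Δ n 1/[k] (suc (suc r))))
    (sumsTo-scaled-difference u (qTerm (suc (suc r)) n) (qTerm (suc r) n)
      (sumsTo-qSum q<1 n (suc r)) (sumsTo-qSum q<1 n r))
    where
    term : ∀ k → u * (qTerm (suc (suc r)) n k - qTerm (suc r) n k) ≈ qTerm (suc r) (suc n) k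
    term k = begin
      -- Raising r by one multiplies the term by q^k, so the difference has the factor q^k - 1,
      -- which `u` turns into [k].
      u * (q ^ (k ℕ.+ suc r ℕ.* k) * B - Q * B)
        ≈⟨ *-congˡ (+-congʳ (*-congʳ (^-homo-* q k (suc r ℕ.* k)))) ⟩
      u * (q ^ k * Q * B - Q * B)
        ≈⟨ solve 4 (λ u x Q B → u :* (x :* Q :* B :- Q :* B)
             := Q :* ((x :- con (+ 1)) :* u :* B)) refl u (q ^ k) Q B ⟩
      Q * ((q ^ k - 1#) * u * B)
        ≈⟨ *-congˡ (*-congʳ ([ι]≈ k)) ⟨
      Q * ([ ι k ] * B) ∎
      where
      Q = q ^ (suc r ℕ.* k)
      B = [ ι k ] ^ n

  -- Splitting `β` into two terms.

  -- The term v ^ suc m comes from k = 0, where k/[k] is 1 by convention and not ι 0 * 1/[k] 0.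
  β-zero : ∀ m → β 0 (suc m) ≈ - ι (suc m) * qSum 1 m + v ^ suc m
  β-zero m = begin
    β 0 (suc m)
      ≈⟨ β≈Δ 0 (suc m) ⟩
    u ^ suc m * Δ (suc m) k/[k] 0
      ≈⟨ *-congˡ (Δ-perturb-zero {g = λ k → ι k * 1/[k] k} (λ _ → refl) (suc m)) ⟩
    u ^ suc m * (Δ (suc m) (λ k → ι k * 1/[k] k) 0 + s * (1# - 0# * 0#))
      ≈⟨ *-congˡ (+-congʳ (Δ-leibniz m 1/[k] 0)) ⟩
    u ^ suc m * (0# * D + ι (suc m) * E + s * (1# - 0# * 0#))
      -- The junk value `1/[k] 0` occurs in D and in the correction, each time multiplied by 0; E
      -- starts at index 1.
      ≈⟨ solve 6 (λ u U D E N s →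
           u :* U :* (con (+ 0) :* D :+ N :* E :+ s :* (con (+ 1) :- con (+ 0) :* con (+ 0)))
           := :- N :* (:- u :* (U :* E)) :+ s :* (u :* U)) refl u (u ^ m) D E (ι (suc m)) s ⟩
    - ι (suc m) * qSum 1 m + s * u ^ suc m
      ≈⟨ +-congˡ (^-distrib-* (- 1#) u (suc m)) ⟨
    - ι (suc m) * qSum 1 m + (- 1# * u) ^ suc m
      ≈⟨ +-congˡ (^-congˡ (suc m) v≈-u) ⟨
    - ι (suc m) * qSum 1 m + v ^ suc m ∎
    where
    s = (- 1#) ^ suc m
    D = Δ (suc m) 1/[k] 0
    E = Δ m 1/[k] 1

  -- At a positive index the convention at k = 0 is invisible, so the Leibniz rule applies without a
  -- correction term.
  β-suc : ∀ r m → β (suc r) (suc m) ≈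
    - ι (suc m) * qSum (suc (suc r)) m + ι (suc r) * (1# - q) * qSum (suc r) (suc m)
  β-suc r m = begin
    β (suc r) (suc m)
      ≈⟨ β≈Δ (suc r) (suc m) ⟩
    u ^ suc m * Δ (suc m) k/[k] (suc r)
      ≈⟨ *-congˡ (Δ-cong-suc {g = λ k → ι k * 1/[k] k} (λ _ → refl) (suc m) r) ⟩
    u ^ suc m * Δ (suc m) (λ k → ι k * 1/[k] k) (suc r)
      ≈⟨ *-congˡ (Δ-leibniz m 1/[k] (suc r)) ⟩
    u ^ suc m * (R * D + N * E)
      ≈⟨ solve 6 (λ u U D E N R → u :* U :* (R :* D :+ N :* E)
           := :- N :* (:- u :* (U :* E)) :+ R :* con (+ 1) :* (u :* U :* D))
                refl u (u ^ m) D E N R ⟩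
    - N * qSum (suc (suc r)) m + R * 1# * (u * u ^ m * D)
      -- The second closed form needs one more factor `u` than is present. Inserting (q - 1) u = 1
      -- supplies it, and the sign in `qSum` turns the remaining q - 1 into 1 - q.
      ≈⟨ +-congˡ (*-congʳ (*-congˡ [q-1]u≈1)) ⟨
    - N * qSum (suc (suc r)) m + R * ((q - 1#) * u) * (u * u ^ m * D)
      ≈⟨ +-congˡ (solve 5 (λ q u U D R → R :* ((q :- con (+ 1)) :* u) :* (u :* U :* D)
           := R :* (con (+ 1) :- q) :* (:- u :* (u :* U :* D))) refl q u (u ^ m) D R) ⟩
    - N * qSum (suc (suc r)) m + R * (1# - q) * qSum (suc r) (suc m) ∎
    where
    R = ι (suc r)
    N = ι (suc m)
    D = Δ (suc m) 1/[k] (suc r)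
    E = Δ m 1/[k] (suc (suc r))

  -- The series with the exponents of the theorem.

  sumsTo-qSum-1 : q < 1# → ∀ m → (λ k → q ^ k * [ ι k ] ^ m) sumsTo qSum 1 m
  sumsTo-qSum-1 q<1 m = sumsTo-cong (qTerm 1 m) _
    (λ k → *-congʳ (^-congʳ q (ℕ.+-identityʳ k))) refl (sumsTo-qSum q<1 m 0)

  sumsTo-qSum-r+1 : q < 1# → ∀ r m →
    (λ k → q ^ ((suc r ℕ.+ 1) ℕ.* k) * [ ι k ] ^ m) sumsTo qSum (suc (suc r)) m
  sumsTo-qSum-r+1 q<1 r m = sumsTo-cong (qTerm (suc (suc r)) m) _
    (λ k → *-congʳ (^-congʳ q (≡.cong (ℕ._* k) (ℕ.+-comm 1 (suc r))))) refl
    (sumsTo-qSum q<1 m (suc r))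

theorem2p19 : ∀ {c ℓ₁ ℓ₂} (ℝ : Reals c ℓ₁ ℓ₂) → let open Analysis ℝ in
    (q : Carrier) (0<q : 0# < q) (q#1 : q # 1#) (P : RealPower q) →
    let open Carlitz q 0<q q#1 P in
    ∣ q ∣< 1# →
    ∀ (r n : ℕ) → n ℕ.≥ 1 →
    (r ≡ 0 →
    ∃[ S ] (λ k → q ^ k * [ ι k ] ^ (n ∸ 1)) sumsTo S
    × β r n ≈ - (ι n) * S + ⟨1-q⟩⁻¹ ^ n)
    ×
    (r ℕ.≥ 1 →
    ∃[ S ] ∃[ T ] (λ k → q ^ ((r ℕ.+ 1) ℕ.* k) * [ ι k ] ^ (n ∸ 1)) sumsTo S
    × (λ k → q ^ (r ℕ.* k) * [ ι k ] ^ n) sumsTo T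
    × β r n ≈ - (ι n) * S + ι r * (1# - q) * T)
theorem2p19 ℝ q 0<q q#1 P (_ , q<1) r (suc m) _ =
  (λ { ≡.refl → qSum 1 m , sumsTo-qSum-1 q<1 m , β-zero m }) ,
  (λ { (ℕ.s≤s {n = r-1} _) → qSum (suc (suc r-1)) m , qSum (suc r-1) (suc m) ,
    sumsTo-qSum-r+1 q<1 r-1 m , sumsTo-qSum q<1 (suc m) r-1 , β-suc r-1 m })
  where open CarlitzSums ℝ q 0<q q#1 P
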